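{- Let $S$ be a well-defined semantic specification, let $\prec$ be the ordering on $\mathcal L$-expressions induced by $S$, and let $\preceq$ be the reflexive closure of $\prec$. Then the tableau calculus $T$ generated from $S$ has the subexpression property with respect to $\preceq$; that is, for every set of concepts $\mathcal S$, all $\mathcal L$-expressions occurring in the tableau derivation $T(\mathcal S)$ belong to $\mathrm{sub}_\preceq(\mathcal S)=\bigcup_{E\in\mathcal S}\{E'\mid E'\preceq E\}$.
   Context: **Object language.** Fix sorts $0,1,\dots,N$ (sort $1$ is primary). An object language $\mathcal L$ is given by a countable set of connectives, each $\sigma$ with a sort $(i_1,\dots,i_m,i_{m+1})$, $m\ge 0$, and by countable sets of variables $p^i_j$ and constants $q^i_j$ for each sort $i$. $\mathcal L^i$ is the smallest set containing the variables and constants of sort $i$ and containing $\sigma(E_1,\dots,E_m)$ whenever $\sigma$ has sort $(i_1,\dots,i_m,i)$ and $E_k\in\mathcal L^{i_k}$. $\mathcal L=\bigcup_i\mathcal L^i$ is the set of expressions; variables and constants are atomic; elements of $\mathcal L^0$ are individuals and of $\mathcal L^1$ concepts. $E(p_1,\dots,p_m)$ indicates variables of $E$, and $E(E_1,\dots,E_m)$ the result of uniform substitution. **Meta-language.** $FO(\mathcal L)$ is a many-sorted first-order language with sorts $0,\dots,N$ and a further domain sort $N+1$. Expressions of sort $i\le N$ are terms of sort $i$ (connectives are function symbols). There are also domain variables, domain constants, function symbols with values of domain sort, constant predicate symbols $P$ with arguments of domain sort, a function symbol $\nu_0$ from sort $0$ to the domain sort, predicate symbols $\nu_n$ ($1\le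 n\le N$) taking one argument of sort $n$ and $n$ arguments of domain sort, and equality $\approx$ on every sort (treated as an ordinary constant predicate symbol). An $\mathcal L$-open sentence is a formula in which all occurrences of variables of sorts $0,\dots,N$ are free and no domain variable is free. $\forall S$ is the set of universal closures of the members of $S$. For a set $S$ of $\mathcal L$-open formulae and a set $X$ of expressions, $S{\upharpoonright}X$ is the set of all instances $\phi(E_1,\dots,E_m)$ of $\phi(p_1,\dots,p_m)\in S$ such that all $\mathcal L$-expressions occurring in $\phi(E_1,\dots,E_m)$ belong to $X$. **Structures.** An $\mathcal L$-structure $\mathcal I$ is a first-order interpretation of $FO(\mathcal L)$ in which sort $i\le N$ is interpreted by $\mathcal L^i$ itself (connectives as term formation) and the domain sort by a non-empty set $\Delta^{\mathcal I}$. A valuation is canonical if it maps every variable and constant of $\mathcal L$ to itself. $S\models_c S'$ means that for every $\mathcal L$-structure $\mathcal I$ and canonical $\iota$, $\mathcal I,\iota\models S$ implies $\mathcal I,\iota\models S'$. **Semantic specification.** A semantic specification of $\mathcal L$ is a set $S$ of $\mathcal L$-open sentences, containing the usual equality axioms for $\approx$ (reflexivity, symmetry, transitivity, congruence for all $P$, $\nu_n$ and functions in domain arguments), which defines every connective: for each $\sigma$ of sort $(i_1,\dots,i_m,n)$ there is a formula $\phi^\sigma$ not containing $\sigma$ with $\forall S\models\forall\overline p\,\forall\overline x\,(\nu_n(\sigma(\overline p),\overline x)\equiv\phi^\sigma(\overline p,\overline x))$. Such definitions $\forall\overline x\,(\nu_n(\sigma(\overline p),\overline x)\equiv\phi^\sigma(\overline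 p,\overline x))$ are fixed, one for each $\sigma$, and form the set $S^0$. $S$ is normalised if $S=S^+\cup S^-\cup S^b$ (disjoint), where $S^+$ consists of sentences $\xi^E_+=\forall\overline x\,(\nu_n(E(\overline p),\overline x)\to\phi^E_+(\overline p,\overline x))$, $S^-$ of sentences $\xi^E_-=\forall\overline x\,(\phi^E_-(\overline p,\overline x)\to\nu_n(E(\overline p),\overline x))$ (at most one of each kind for each expression $E$), and all $\mathcal L$-expressions occurring in $S^b$ (the background theory, which includes the equality axioms) are atomic. For an expression $E$, $\Phi^E_+$ (resp. $\Phi^E_-$) is the set of all $\phi^F_+(E_1,\dots,E_m,\overline x)$ (resp. $\phi^F_-(E_1,\dots,E_m,\overline x)$) such that $E=F(E_1,\dots,E_m)$ for some $\xi^{F(p_1,\dots,p_m)}_+$ (resp. $\xi^{F(p_1,\dots,p_m)}_-$) in $S$. The relation $\prec$ induced by $S$ is the smallest transitive relation on expressions with $E'\prec E$ whenever $E=F(E_1,\dots,E_m)$ and $E'$ occurs in $\phi^F_+(E_1,\dots,E_m,\overline x)$ or $\phi^F_-(E_1,\dots,E_m,\overline x)$ for some $\xi^F_+$ or $\xi^F_-$ in $S$. $\mathrm{sub}_\prec(E)=\{E'\mid E'\prec E\}$. $S$ is well-defined if it is normalised and: (wd1) $\forall S^0,\forall S^b\models\forall S$; (wd2) $\prec$ is a well-founded ordering on expressions; (wd3) for every expression $E=\sigma(E_1,\dots,E_m)$, $\forall S^0,\,S^b{\upharpoonright}\mathrm{sub}_\prec(E)\models_c\forall\overline x\big((\bigwedge\Phi^E_+\to\phi^\sigma(E_1,\dots,E_m,\overline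 x))\wedge(\phi^\sigma(E_1,\dots,E_m,\overline x)\to\bigvee\Phi^E_-)\big)$. **Tableaux.** A tableau calculus is a set of rules $X_0/X_1\mid\cdots\mid X_n$ with $X_i$ finite non-empty sets of literals of $FO(\mathcal L)$; if $n=0$ it is a closure rule, written $X_0/\bot$. A tableau is a finitely branching tree of sets of formulae; for an input set $\mathcal S$ of concepts the root is $\{\nu_1(C,a)\mid C\in\mathcal S\}$ with $a$ a fresh domain constant. A rule is applicable to a node if an instance of all its premises lies in the node ($\mathcal L$-variables are instantiated by expressions, domain variables by ground domain terms); it creates $n$ successors, the $i$-th adding the corresponding instance of $X_i$; each rule is applied at most once to the same premises. $T(\mathcal S)$ denotes a finished tableau (all applicable rules have been applied on all branches, in the limit). **The calculus $T$ generated from $S$** consists of: (t1) for each $\xi^E_+\in S^+$: Skolemise and rewrite to $\forall\overline x(\nu_n(E(\overline p),\overline x)\to\bigvee_{j=1}^J\bigwedge_{k=1}^{K_j}\psi_{jk})$ with literals $\psi_{jk}$, and take the rule with premises $\nu_n(E(\overline p),\overline x),\,y_1\approx y_1,\dots,y_s\approx y_s$ (the $y_i$ being the free variables of the $\psi_{jk}$ not among $\overline x$) and denominators $\{\psi_{j1},\dots,\psi_{jK_j}\}$, $j=1,\dots,J$; for each $\xi^E_-\in S^-$ do the same with the contrapositive $\forall\overline x(\neg\nu_n(E(\overline p),\overline x)\to\bigvee_j\bigwedge_k\psi_{jk})$ and main premise $\neg\nu_n(E(\overline p),\overline x)$; (t2) for each non-equality sentence of $S^b$, rewritten in Skolemised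 disjunctive form $\forall\overline x\bigvee_j\bigwedge_k\psi_{jk}(\overline p,\overline x)$: the rule with premises $p_i\approx p_i$, $x_i\approx x_i$ (all variables occurring) and denominators $\{\psi_{j1},\dots,\psi_{jK_j}\}$; (t3) equality rules, for all predicates $P$ (including $\approx$), $\nu_n$ and functions $f$ (including Skolem functions) involved: $(\neg)P(\overline x)/x_1\approx x_1,\dots,x_n\approx x_n$; $(\neg)\nu_n(p,\overline x)/p\approx p,x_1\approx x_1,\dots,x_n\approx x_n$; $x\approx y/y\approx x$; $x\approx y,\,y\approx z/x\approx z$; $P(\overline x),x_i\approx y_i/P(\dots,y_i,\dots)$; $\nu_n(p,\overline x),x_i\approx y_i/\nu_n(p,\dots,y_i,\dots)$; $f(\overline p,\overline x)\approx f(\overline p,\overline x),\,x_i\approx y_i/f(\overline p,\overline x)\approx f(\overline p,\dots,y_i,\dots)$; (t4) closure rules $\nu_n(p,\overline x),\neg\nu_n(p,\overline x)/\bot$ and $P(\overline x),\neg P(\overline x)/\bot$.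
   Formalization: In (t2) the premises also include q≈q for constants q occurring in the background sentence (otherwise the lemma fails: ∀x ν₁(q,x), input p); Skolem functions take as arguments the expressions occurring in the existential subformula, not the variables inside them. -}

module Defs where

open import Level using (0ℓ)
open import Data.Bool using (Bool; true; false)
open import Data.Empty using (⊥)
open import Data.Fin using (Fin; zero; suc; toℕ)
open import Data.List using (List; []; _∷_; _++_; map; concatMap; mapMaybe; allFin; length; lookup; cartesianProductWith)
open import Data.List.Membership.Propositional using (_∈_; _∉_)
open import Data.List.Relation.Unary.All using (All; []; _∷_; reduce)
open import Data.Maybe using (Maybe; just; nothing)
open import Data.Nat using (ℕ; zero; suc; _<_)
open import Data.Product using (Σ-syntax; ∃-syntax; _×_; _,_; proj₁)
open import Data.Sum using (_⊎_; inj₁; inj₂; isInj₂)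
open import Data.Unit using (⊤; tt)
open import Data.Vec using (Vec; []; _∷_; tabulate; fromList; _[_]≔_)
import Data.Vec as Vec
import Data.Vec.Functional as Env
open import Function using (_∘_; _↣_)
open import Induction.WellFounded using (WellFounded)
open import Relation.Binary using (Rel)
open import Relation.Binary.Construct.Closure.Reflexive using (ReflClosure)
open import Relation.Binary.Construct.Closure.Transitive using (TransClosure)
open import Relation.Binary.PropositionalEquality using (_≡_; _≢_)
open import Relation.Nullary using (¬_)
open import Relation.Unary using (Pred; _⊆_; _≐_; _∪_) renaming (_⊥_ to _disjoint_)

-- The sorts are 0, …, N with N = suc rank ≥ 1.  The variables are not listed:
-- there is a variable pⁱⱼ for each sort i and each j : ℕ.
record Language : Set₁ where
  field
    rank : ℕ

  Sort : Set
  Sort = Fin (suc (suc rank))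

  field
    Con            : Sort → Set
    Conn           : List Sort → Sort → Set
    con-countable  : ∀ i → Con i ↣ ℕ
    conn-countable : (Σ[ is ∈ List Sort ] Σ[ i ∈ Sort ] Conn is i) ↣ ℕ

module Syntax (𝓛 : Language) where
  open Language 𝓛 public

  data Expr : Sort → Set where
    var : ∀ {i} → ℕ → Expr i
    con : ∀ {i} → Con i → Expr i
    app : ∀ {is i} → Conn is i → All Expr is → Expr i

  Expression : Set
  Expression = Σ[ i ∈ Sort ] Expr i

  Concept : Set
  Concept = Expr (suc zero)

  data Atomic : Expression → Set where
    var : ∀ {i} j → Atomic (i , var j)
    con : ∀ {i} q → Atomic (i , con q)

  -- E(E₁,…,Eₘ) is rendered as E θ for a substitution θ with pₖ ↦ Eₖ.
  Subst : Set
  Subst = ∀ i → ℕ → Expr i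

  mutual
    substE : Subst → ∀ {i} → Expr i → Expr i
    substE θ (var j)    = θ _ j
    substE θ (con q)    = con q
    substE θ (app σ es) = app σ (substEs θ es)

    substEs : Subst → ∀ {is} → All Expr is → All Expr is
    substEs θ []       = []
    substEs θ (e ∷ es) = substE θ e ∷ substEs θ es

  -- The tuple p̄ of pairwise distinct variables of the given sorts.
  variablesFrom : ℕ → ∀ is → All Expr is
  variablesFrom j []       = []
  variablesFrom j (i ∷ is) = var j ∷ variablesFrom (suc j) is

  variables : ∀ is → All Expr is
  variables = variablesFrom 0

  mutual
    varsE : ∀ {i} → Expr i → List (Sort × ℕ)
    varsE {i} (var j) = (i , j) ∷ []
    varsE (con q)     = []
    varsE (app σ es)  = varsEs es

    varsEs : ∀ {is} → All Expr is → List (Sort × ℕ)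
    varsEs []       = []
    varsEs (e ∷ es) = varsE e ++ varsEs es

  Connective : Set
  Connective = Σ[ is ∈ List Sort ] Σ[ i ∈ Sort ] Conn is i

  mutual
    connsE : ∀ {i} → Expr i → List Connective
    connsE (var j)    = []
    connsE (con q)    = []
    connsE (app σ es) = (_ , _ , σ) ∷ connsEs es

    connsEs : ∀ {is} → All Expr is → List Connective
    connsEs []       = []
    connsEs (e ∷ es) = connsE e ++ connsEs es

  expressions : ∀ {is} → All Expr is → List Expression
  expressions = reduce (λ {i} e → i , e)

  packed : (es : List Expression) → All Expr (map proj₁ es)
  packed []             = []
  packed ((_ , e) ∷ es) = e ∷ packed es

  -- The symbols of FO(𝓛) that are not fixed by 𝓛.  A function symbol takes
  -- arguments of sorts `funSorts f` followed by `funArity f` domain arguments;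
  -- domain constants are the function symbols without arguments.
  record Signature : Set₁ where
    field
      Fun       : Set
      funSorts  : Fun → List Sort
      funArity  : Fun → ℕ
      Pr        : Set
      predArity : Pr → ℕ

  module Terms (Γ : Signature) where
    open Signature Γ

    data FunSym : Set where
      ν₀  : FunSym
      fun : Fun → FunSym

    sorts : FunSym → List Sort
    sorts ν₀      = zero ∷ []
    sorts (fun f) = funSorts f

    arity : FunSym → ℕ
    arity ν₀      = 0
    arity (fun f) = funArity f

    -- ν i is the predicate symbol of the sort n = suc i ≥ 1.
    data RelSym : Set where
      ν    : Fin (suc rank) → RelSym
      pred : Pr → RelSym
      ≈ᴱ   : Sort → RelSym
      ≈ᴰ   : RelSym

    sortsᴿ : RelSym → List Sort
    sortsᴿ (ν i)    = suc i ∷ []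
    sortsᴿ (pred P) = []
    sortsᴿ (≈ᴱ i)   = i ∷ i ∷ []
    sortsᴿ ≈ᴰ       = []

    arityᴿ : RelSym → ℕ
    arityᴿ (ν i)    = suc (toℕ i)
    arityᴿ (pred P) = predArity P
    arityᴿ (≈ᴱ i)   = 0
    arityᴿ ≈ᴰ       = 2

    data Term (V : Set) : Set where
      var : V → Term V
      fn  : (f : FunSym) → All Expr (sorts f) → Vec (Term V) (arity f) → Term V

    data Atom (V : Set) : Set where
      rel : (R : RelSym) → All Expr (sortsᴿ R) → Vec (Term V) (arityᴿ R) → Atom V

    data Literal (V : Set) : Set where
      pos neg : Atom V → Literal V

    νᵃ : ∀ {V} i → Expr (suc i) → Vec (Term V) (suc (toℕ i)) → Atom V
    νᵃ i E ts = rel (ν i) (E ∷ []) ts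

    _≈ᵃ_ : ∀ {V} → Term V → Term V → Atom V
    s ≈ᵃ t = rel ≈ᴰ [] (s ∷ t ∷ [])

    _≈ᵉ_ : ∀ {V i} → Expr i → Expr i → Atom V
    E ≈ᵉ E′ = rel (≈ᴱ _) (E ∷ E′ ∷ []) []

    module _ {V W : Set} (θ : Subst) (ρ : V → Term W) where
      mutual
        substT : Term V → Term W
        substT (var x)      = ρ x
        substT (fn f es ts) = fn f (substEs θ es) (substTs ts)

        substTs : ∀ {n} → Vec (Term V) n → Vec (Term W) n
        substTs []       = []
        substTs (t ∷ ts) = substT t ∷ substTs ts

      substA : Atom V → Atom W
      substA (rel R es ts) = rel R (substEs θ es) (substTs ts)

      substL : Literal V → Literal W
      substL (pos A) = pos (substA A)
      substL (neg A) = neg (substA A)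

    -- The 𝓛-expressions occurring in a term, literal or formula of FO(𝓛) are
    -- the expressions standing in argument places of its predicate and function
    -- symbols, at any depth in its domain terms.  Proper subexpressions of such
    -- an argument are not thereby occurrences: they need not be related to it
    -- by ≺.
    module _ {V : Set} where
      mutual
        occT : Term V → List Expression
        occT (var x)      = []
        occT (fn f es ts) = expressions es ++ occTs ts

        occTs : ∀ {n} → Vec (Term V) n → List Expression
        occTs []       = []
        occTs (t ∷ ts) = occT t ++ occTs ts

      occA : Atom V → List Expression
      occA (rel R es ts) = expressions es ++ occTs ts

      occL : Literal V → List Expression
      occL (pos A) = occA A
      occL (neg A) = occA A

      mutual
        domVarsT : Term V → List V
        domVarsT (var x)      = x ∷ []
        domVarsT (fn f es ts) = domVarsTs ts

        domVarsTs : ∀ {n} → Vec (Term V) n → List V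
        domVarsTs []       = []
        domVarsTs (t ∷ ts) = domVarsT t ++ domVarsTs ts

      domVarsL : Literal V → List V
      domVarsL (pos (rel R es ts)) = domVarsTs ts
      domVarsL (neg (rel R es ts)) = domVarsTs ts

module FO (𝓛 : Language) (Γ : Syntax.Signature 𝓛) where
  open Syntax 𝓛 public
  open Terms Γ public

  -- 𝓛-open formulae: 𝓛-variables are never quantified, and the domain
  -- variables are de Bruijn indices, n of which are free.
  data Formula (n : ℕ) : Set where
    atom           : Atom (Fin n) → Formula n
    ⊥ᶠ             : Formula n
    ¬ᶠ_            : Formula n → Formula n
    _∧ᶠ_ _∨ᶠ_ _⇒ᶠ_ : Formula n → Formula n → Formula n
    ∀ᶠ_ ∃ᶠ_        : Formula (suc n) → Formula n

  Sentence : Set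
  Sentence = Formula 0

  _⇔ᶠ_ : ∀ {n} → Formula n → Formula n → Formula n
  φ ⇔ᶠ ψ = (φ ⇒ᶠ ψ) ∧ᶠ (ψ ⇒ᶠ φ)

  ∀ᶠ* : ∀ {n} → Formula n → Sentence
  ∀ᶠ* {zero}  φ = φ
  ∀ᶠ* {suc n} φ = ∀ᶠ* (∀ᶠ φ)

  substF : Subst → ∀ {n} → Formula n → Formula n
  substF θ (atom A) = atom (substA θ var A)
  substF θ ⊥ᶠ       = ⊥ᶠ
  substF θ (¬ᶠ φ)   = ¬ᶠ substF θ φ
  substF θ (φ ∧ᶠ ψ) = substF θ φ ∧ᶠ substF θ ψ
  substF θ (φ ∨ᶠ ψ) = substF θ φ ∨ᶠ substF θ ψ
  substF θ (φ ⇒ᶠ ψ) = substF θ φ ⇒ᶠ substF θ ψ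
  substF θ (∀ᶠ φ)   = ∀ᶠ substF θ φ
  substF θ (∃ᶠ φ)   = ∃ᶠ substF θ φ

  occF : ∀ {n} → Formula n → List Expression
  occF (atom A) = occA A
  occF ⊥ᶠ       = []
  occF (¬ᶠ φ)   = occF φ
  occF (φ ∧ᶠ ψ) = occF φ ++ occF ψ
  occF (φ ∨ᶠ ψ) = occF φ ++ occF ψ
  occF (φ ⇒ᶠ ψ) = occF φ ++ occF ψ
  occF (∀ᶠ φ)   = occF φ
  occF (∃ᶠ φ)   = occF φ

  varsF : ∀ {n} → Formula n → List (Sort × ℕ)
  varsF φ = concatMap (λ (_ , E) → varsE E) (occF φ)

  connsF : ∀ {n} → Formula n → List Connective
  connsF φ = concatMap (λ (_ , E) → connsE E) (occF φ)

  x̄ : ∀ {n} → Vec (Term (Fin n)) n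
  x̄ = tabulate var

  record Interpretation : Set₁ where
    field
      ∣_∣       : Sort → Set
      inhabited : ∀ i → ∣_∣ i
      conn      : ∀ {is i} → Conn is i → All ∣_∣ is → ∣_∣ i
      Δ         : Set
      nonempty  : Δ
      ⟦_⟧ᶠ      : (f : FunSym) → All ∣_∣ (sorts f) → Vec Δ (arity f) → Δ
      ⟦_⟧ᴿ      : (R : RelSym) → All ∣_∣ (sortsᴿ R) → Vec Δ (arityᴿ R) → Set

  -- A valuation assigns values to the variables and to the constants of 𝓛.
  record Valuation (I : Interpretation) : Set where
    constructor valuation
    open Interpretation I
    field
      ofVar : ∀ i → ℕ → ∣_∣ i
      ofCon : ∀ i → Con i → ∣_∣ i

  module _ (I : Interpretation) (v : Valuation I) where
    open Interpretation I
    open Valuation v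

    mutual
      ⟦_⟧ : ∀ {i} → Expr i → ∣_∣ i
      ⟦ var j ⟧    = ofVar _ j
      ⟦ con q ⟧    = ofCon _ q
      ⟦ app σ es ⟧ = conn σ ⟦ es ⟧*

      ⟦_⟧* : ∀ {is} → All Expr is → All ∣_∣ is
      ⟦ [] ⟧*     = []
      ⟦ e ∷ es ⟧* = ⟦ e ⟧ ∷ ⟦ es ⟧*

    module _ {V : Set} (η : V → Δ) where
      mutual
        evalT : Term V → Δ
        evalT (var x)      = η x
        evalT (fn f es ts) = ⟦ f ⟧ᶠ ⟦ es ⟧* (evalTs ts)

        evalTs : ∀ {n} → Vec (Term V) n → Vec Δ n
        evalTs []       = []
        evalTs (t ∷ ts) = evalT t ∷ evalTs ts

    -- Atoms, ∨ and ∃ are double-negated, which makes this the classical notion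
    -- of truth.
    sat : ∀ {n} → (Fin n → Δ) → Formula n → Set
    sat η (atom (rel R es ts)) = ¬ ¬ ⟦ R ⟧ᴿ ⟦ es ⟧* (evalTs η ts)
    sat η ⊥ᶠ       = ⊥
    sat η (¬ᶠ φ)   = ¬ sat η φ
    sat η (φ ∧ᶠ ψ) = sat η φ × sat η ψ
    sat η (φ ∨ᶠ ψ) = ¬ ¬ (sat η φ ⊎ sat η ψ)
    sat η (φ ⇒ᶠ ψ) = sat η φ → sat η ψ
    sat η (∀ᶠ φ)   = ∀ d → sat (d Env.∷ η) φ
    sat η (∃ᶠ φ)   = ¬ ¬ (∃[ d ] sat (d Env.∷ η) φ)

  _,_⊨_ : (I : Interpretation) → Valuation I → Sentence → Set
  I , v ⊨ φ = sat I v (λ ()) φ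

  -- Truth of the universal closure of an 𝓛-open sentence.
  _,_⊨∀_ : (I : Interpretation) → Valuation I → Sentence → Set
  I , v ⊨∀ φ = ∀ w → I , valuation w (Valuation.ofCon v) ⊨ φ

  _∀⊨∀_ : Pred Sentence 0ℓ → Pred Sentence 0ℓ → Set₁
  A ∀⊨∀ B = ∀ I v → (∀ φ → A φ → I , v ⊨∀ φ) → ∀ φ → B φ → I , v ⊨∀ φ

  record 𝓛-Structure : Set₁ where
    field
      Δ        : Set
      nonempty : Δ
      ⟦_⟧ᶠ     : (f : FunSym) → All Expr (sorts f) → Vec Δ (arity f) → Δ
      ⟦_⟧ᴿ     : (R : RelSym) → All Expr (sortsᴿ R) → Vec Δ (arityᴿ R) → Set

    interpretation : Interpretation
    interpretation = record
      { ∣_∣ = Expr ; inhabited = λ i → var 0 ; conn = app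
      ; Δ = Δ ; nonempty = nonempty ; ⟦_⟧ᶠ = ⟦_⟧ᶠ ; ⟦_⟧ᴿ = ⟦_⟧ᴿ }

    canonical : Valuation interpretation
    canonical = valuation (λ i → var) (λ i → con)

  -- Congruence is stated one domain argument at a time; the bound variables of the congruence axioms are y, followed by x̄.
  private
    y : ∀ {n} → Term (Fin (suc n))
    y = var zero

    x̄′ : ∀ {n} → Vec (Term (Fin (suc n))) n
    x̄′ = tabulate (λ k → var (suc k))

  data EqualityAxiom : Sentence → Set where
    reflᴱ  : ∀ i → EqualityAxiom (atom (var {i} 0 ≈ᵉ var 0))
    symᴱ   : ∀ i → EqualityAxiom
               (atom (var {i} 0 ≈ᵉ var 1) ⇒ᶠ atom (var {i} 1 ≈ᵉ var 0))
    transᴱ : ∀ i → EqualityAxiom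
               ((atom (var {i} 0 ≈ᵉ var 1) ∧ᶠ atom (var {i} 1 ≈ᵉ var 2))
                  ⇒ᶠ atom (var {i} 0 ≈ᵉ var 2))
    reflᴰ  : EqualityAxiom (∀ᶠ* {1} (atom (var zero ≈ᵃ var zero)))
    symᴰ   : EqualityAxiom
               (∀ᶠ* {2} (atom (var zero ≈ᵃ var (suc zero))
                  ⇒ᶠ atom (var (suc zero) ≈ᵃ var zero)))
    transᴰ : EqualityAxiom
               (∀ᶠ* {3} ((atom (var zero ≈ᵃ var (suc zero))
                  ∧ᶠ atom (var (suc zero) ≈ᵃ var (suc (suc zero))))
                  ⇒ᶠ atom (var zero ≈ᵃ var (suc (suc zero)))))
    congᴿ  : ∀ R (k : Fin (arityᴿ R)) → EqualityAxiom
               (∀ᶠ* ((atom (rel R (variables _) x̄′) ∧ᶠ atom (var (suc k) ≈ᵃ y))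
                  ⇒ᶠ atom (rel R (variables _) (x̄′ [ k ]≔ y))))
    congᶠ  : ∀ f (k : Fin (arity f)) → EqualityAxiom
               (∀ᶠ* (atom (var (suc k) ≈ᵃ y)
                  ⇒ᶠ atom (fn f (variables _) x̄′ ≈ᵃ fn f (variables _) (x̄′ [ k ]≔ y))))

  -- ∀x̄ (νₙ(σ(p̄),x̄) ≡ φ(p̄,x̄)) with n = suc i.  Only connectives whose value has
  -- a sort n ≥ 1 can have such a definition, since ν₀ is a function symbol.
  definition : ∀ {is i} → Conn is (suc i) → Formula (suc (toℕ i)) → Sentence
  definition σ φ = ∀ᶠ* (atom (νᵃ _ (app σ (variables _)) x̄) ⇔ᶠ φ)

  record SemanticSpecification : Set₁ where
    field
      S        : Pred Sentence 0ℓ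
      equality : EqualityAxiom ⊆ S
      φ^       : ∀ {is i} → Conn is (suc i) → Formula (suc (toℕ i))
      φ^-vars  : ∀ {is i} (σ : Conn is (suc i)) {p} →
                   p ∈ varsF (φ^ σ) → p ∈ varsEs (variables is)
      φ^-fresh : ∀ {is i} (σ : Conn is (suc i)) → (is , suc i , σ) ∉ connsF (φ^ σ)
      φ^-def   : ∀ {is i} (σ : Conn is (suc i)) → S ∀⊨∀ (definition σ (φ^ σ) ≡_)

    data S⁰ : Pred Sentence 0ℓ where
      def : ∀ {is i} (σ : Conn is (suc i)) → S⁰ (definition σ (φ^ σ))

  ξ₊ ξ₋ : ∀ {i} → Expr (suc i) → Formula (suc (toℕ i)) → Sentence
  ξ₊ E φ = ∀ᶠ* (atom (νᵃ _ E x̄) ⇒ᶠ φ)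
  ξ₋ E φ = ∀ᶠ* (φ ⇒ᶠ atom (νᵃ _ E x̄))

  record Normalised (𝓢 : SemanticSpecification) : Set₁ where
    open SemanticSpecification 𝓢
    field
      S⁺ S⁻ Sᵇ : Pred Sentence 0ℓ
      split    : S ≐ (S⁺ ∪ S⁻ ∪ Sᵇ)
      S⁺⊥S⁻    : S⁺ disjoint S⁻
      S⁺⊥Sᵇ    : S⁺ disjoint Sᵇ
      S⁻⊥Sᵇ    : S⁻ disjoint Sᵇ
      S⁺-form  : ∀ {ξ} → S⁺ ξ → ∃[ i ] ∃[ E ] ∃[ φ ]
                   (ξ ≡ ξ₊ {i} E φ × (∀ {p} → p ∈ varsF φ → p ∈ varsE E))
      S⁻-form  : ∀ {ξ} → S⁻ ξ → ∃[ i ] ∃[ E ] ∃[ φ ]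
                   (ξ ≡ ξ₋ {i} E φ × (∀ {p} → p ∈ varsF φ → p ∈ varsE E))
      S⁺-once  : ∀ {i} {E : Expr (suc i)} {φ ψ} → S⁺ (ξ₊ E φ) → S⁺ (ξ₊ E ψ) → φ ≡ ψ
      S⁻-once  : ∀ {i} {E : Expr (suc i)} {φ ψ} → S⁻ (ξ₋ E φ) → S⁻ (ξ₋ E ψ) → φ ≡ ψ
      Sᵇ-atoms : ∀ {ξ} → Sᵇ ξ → All Atomic (occF ξ)
      Sᵇ-eq    : EqualityAxiom ⊆ Sᵇ

    data Φ₊ {i} : Expr (suc i) → Formula (suc (toℕ i)) → Set where
      inst : ∀ F φ (θ : Subst) → S⁺ (ξ₊ F φ) → Φ₊ (substE θ F) (substF θ φ)

    data Φ₋ {i} : Expr (suc i) → Formula (suc (toℕ i)) → Set where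
      inst : ∀ F φ (θ : Subst) → S⁻ (ξ₋ F φ) → Φ₋ (substE θ F) (substF θ φ)

    data _≺₁_ : Rel Expression 0ℓ where
      plus  : ∀ {i} {E : Expr (suc i)} {φ E′} → Φ₊ E φ → E′ ∈ occF φ → E′ ≺₁ (suc i , E)
      minus : ∀ {i} {E : Expr (suc i)} {φ E′} → Φ₋ E φ → E′ ∈ occF φ → E′ ≺₁ (suc i , E)

    _≺_ _≼_ : Rel Expression 0ℓ
    _≺_ = TransClosure _≺₁_
    _≼_ = ReflClosure _≺_

  data _↾_ (A : Pred Sentence 0ℓ) (X : Pred Expression 0ℓ) : Pred Sentence 0ℓ where
    inst : ∀ {φ} (θ : Subst) → A φ → All X (occF (substF θ φ)) → (A ↾ X) (substF θ φ)

  record WellDefined (𝓢 : SemanticSpecification) : Set₁ where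
    open SemanticSpecification 𝓢
    field
      normalised : Normalised 𝓢
    open Normalised normalised
    field
      wd1 : (S⁰ ∪ Sᵇ) ∀⊨∀ S
      wd2 : WellFounded _≺_
      wd3 : ∀ {is i} (σ : Conn is (suc i)) (θ : Subst) →
            let E = substE θ (app σ (variables is))
                φ = substF θ (φ^ σ) in
            (I : 𝓛-Structure) → let open 𝓛-Structure I in
            (∀ ψ → S⁰ ψ → interpretation , canonical ⊨∀ ψ) →
            (∀ ψ → (Sᵇ ↾ (_≺ (suc i , E))) ψ → interpretation , canonical ⊨ ψ) →
            ∀ (η : Fin (suc (toℕ i)) → Δ) →
            let _⊨η = sat interpretation canonical η in
            ((∀ ψ → Φ₊ E ψ → ψ ⊨η) → φ ⊨η)
            × (φ ⊨η → ¬ ¬ (∃[ ψ ] (Φ₋ E ψ × ψ ⊨η)))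

  data NNF (n : ℕ) : Set where
    lit       : Literal (Fin n) → NNF n
    ⊤ᴺ ⊥ᴺ     : NNF n
    _∧ᴺ_ _∨ᴺ_ : NNF n → NNF n → NNF n
    ∀ᴺ_ ∃ᴺ_   : NNF (suc n) → NNF n

  mutual
    nnf : ∀ {n} → Formula n → NNF n
    nnf (atom A) = lit (pos A)
    nnf ⊥ᶠ       = ⊥ᴺ
    nnf (¬ᶠ φ)   = nnf¬ φ
    nnf (φ ∧ᶠ ψ) = nnf φ ∧ᴺ nnf ψ
    nnf (φ ∨ᶠ ψ) = nnf φ ∨ᴺ nnf ψ
    nnf (φ ⇒ᶠ ψ) = nnf¬ φ ∨ᴺ nnf ψ
    nnf (∀ᶠ φ)   = ∀ᴺ nnf φ
    nnf (∃ᶠ φ)   = ∃ᴺ nnf φ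

    nnf¬ : ∀ {n} → Formula n → NNF n
    nnf¬ (atom A) = lit (neg A)
    nnf¬ ⊥ᶠ       = ⊤ᴺ
    nnf¬ (¬ᶠ φ)   = nnf φ
    nnf¬ (φ ∧ᶠ ψ) = nnf¬ φ ∨ᴺ nnf¬ ψ
    nnf¬ (φ ∨ᶠ ψ) = nnf¬ φ ∧ᴺ nnf¬ ψ
    nnf¬ (φ ⇒ᶠ ψ) = nnf φ ∧ᴺ nnf¬ ψ
    nnf¬ (∀ᶠ φ)   = ∃ᴺ nnf¬ φ
    nnf¬ (∃ᶠ φ)   = ∀ᴺ nnf¬ φ

  occN : ∀ {n} → NNF n → List Expression
  occN (lit L)  = occL L
  occN ⊤ᴺ       = []
  occN ⊥ᴺ       = []
  occN (F ∧ᴺ G) = occN F ++ occN G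
  occN (F ∨ᴺ G) = occN F ++ occN G
  occN (∀ᴺ F)   = occN F
  occN (∃ᴺ F)   = occN F

  -- The position of a subformula, innermost step first.
  Path : Set
  Path = List Bool

  -- One Skolem symbol for each occurrence of an existential quantifier in each
  -- sentence of the specification.
  record SkolemSymbol : Set where
    constructor skolem
    field
      origin  : Sentence
      path    : Path
      skSorts : List Sort
      skArity : ℕ

  -- FO(𝓛) with the Skolem functions and the fresh domain constant a.
  Γ⁺ : Signature
  Γ⁺ = record
    { Fun       = Signature.Fun Γ ⊎ SkolemSymbol ⊎ ⊤
    ; funSorts  = λ { (inj₁ f)        → Signature.funSorts Γ f
                    ; (inj₂ (inj₁ f)) → SkolemSymbol.skSorts f
                    ; (inj₂ (inj₂ _)) → [] }
    ; funArity  = λ { (inj₁ f)        → Signature.funArity Γ f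
                    ; (inj₂ (inj₁ f)) → SkolemSymbol.skArity f
                    ; (inj₂ (inj₂ _)) → 0 }
    ; Pr        = Signature.Pr Γ
    ; predArity = Signature.predArity Γ
    }

  module ⁺ = Terms Γ⁺

  module _ {V W : Set} (ρ : V → ⁺.Term W) where
    mutual
      embedT : Term V → ⁺.Term W
      embedT (var x)            = ρ x
      embedT (fn ν₀ es ts)      = ⁺.fn ⁺.ν₀ es []
      embedT (fn (fun f) es ts) = ⁺.fn (⁺.fun (inj₁ f)) es (embedTs ts)

      embedTs : ∀ {n} → Vec (Term V) n → Vec (⁺.Term W) n
      embedTs []       = []
      embedTs (t ∷ ts) = embedT t ∷ embedTs ts

    embedA : Atom V → ⁺.Atom W
    embedA (rel (ν i) es ts)    = ⁺.rel (⁺.ν i) es (embedTs ts)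
    embedA (rel (pred P) es ts) = ⁺.rel (⁺.pred P) es (embedTs ts)
    embedA (rel (≈ᴱ i) es ts)   = ⁺.rel (⁺.≈ᴱ i) es (embedTs ts)
    embedA (rel ≈ᴰ es ts)       = ⁺.rel ⁺.≈ᴰ es (embedTs ts)

    embedL : Literal V → ⁺.Literal W
    embedL (pos A) = ⁺.pos (embedA A)
    embedL (neg A) = ⁺.neg (embedA A)

  -- The domain variables of a rule obtained from a formula: its free variables
  -- x̄, and a variable for each universal quantifier, named by its position.
  RuleVar : ℕ → Set
  RuleVar n = Fin n ⊎ Path

  Clauses : Set → Set
  Clauses V = List (List (⁺.Literal V))

  -- Skolemisation followed by distribution of ∧ over ∨; the result stands for
  -- the disjunction of the conjunctions of its members.  A Skolem function is
  -- applied to the parameters of the existential subformula that it witnesses,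
  -- namely the 𝓛-expressions occurring in that subformula (the variables p̄ when
  -- these expressions are variables), and to the universally quantified domain
  -- variables in scope.
  module Skolemisation (ξ : Sentence) {k : ℕ} where

    witness : ∀ {n} → Path → List (RuleVar k) → NNF (suc n) → ⁺.Term (RuleVar k)
    witness π scope F =
      ⁺.fn (⁺.fun (inj₂ (inj₁ (skolem ξ π (map proj₁ (occN F)) (length scope)))))
           (packed (occN F)) (Vec.map ⁺.var (fromList scope))

    clauses : ∀ {n} → Path → List (RuleVar k) → (Fin n → ⁺.Term (RuleVar k)) →
              NNF n → Clauses (RuleVar k)
    clauses π scope ρ (lit L)  = (embedL ρ L ∷ []) ∷ []
    clauses π scope ρ ⊤ᴺ       = [] ∷ []
    clauses π scope ρ ⊥ᴺ       = []
    clauses π scope ρ (F ∧ᴺ G) = cartesianProductWith _++_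
      (clauses (false ∷ π) scope ρ F) (clauses (true ∷ π) scope ρ G)
    clauses π scope ρ (F ∨ᴺ G) =
      clauses (false ∷ π) scope ρ F ++ clauses (true ∷ π) scope ρ G
    clauses π scope ρ (∀ᴺ F)   =
      clauses (false ∷ π) (inj₂ π ∷ scope) (⁺.var (inj₂ π) Env.∷ ρ) F
    clauses π scope ρ (∃ᴺ F)   =
      clauses (false ∷ π) scope (witness π scope F Env.∷ ρ) F

    disjunctiveForm : NNF k → Clauses (RuleVar k)
    disjunctiveForm = clauses [] (map inj₁ (allFin k)) (⁺.var ∘ inj₁)

  open Skolemisation using (disjunctiveForm)

  record Rule : Set₁ where
    constructor rule
    field
      {DomVar}     : Set
      premises     : List (⁺.Literal DomVar)
      denominators : Clauses DomVar

  ≈ᵗ-self : ∀ {V} → ⁺.Term V → ⁺.Literal V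
  ≈ᵗ-self t = ⁺.pos (t ⁺.≈ᵃ t)

  ≈ᵉ-self : ∀ {V} → Expression → ⁺.Literal V
  ≈ᵉ-self (_ , E) = ⁺.pos (E ⁺.≈ᵉ E)

  -- yᵢ ≈ yᵢ for the variables of the clauses that are not among x̄.
  ȳ≈ȳ : ∀ {n} → Clauses (RuleVar n) → List (⁺.Literal (RuleVar n))
  ȳ≈ȳ cs = map (≈ᵗ-self ∘ ⁺.var ∘ inj₂)
               (mapMaybe isInj₂ (concatMap (concatMap ⁺.domVarsL) cs))

  x̄ʳ : ∀ {n} → Vec (⁺.Term (RuleVar n)) n
  x̄ʳ = tabulate (⁺.var ∘ inj₁)

  rule₊ rule₋ : ∀ {i} → Expr (suc i) → Formula (suc (toℕ i)) → Rule
  rule₊ {i} E φ = rule (⁺.pos (⁺.νᵃ i E x̄ʳ) ∷ ȳ≈ȳ cs) cs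
    where cs = disjunctiveForm (ξ₊ E φ) (nnf φ)
  rule₋ {i} E φ = rule (⁺.neg (⁺.νᵃ i E x̄ʳ) ∷ ȳ≈ȳ cs) cs
    where cs = disjunctiveForm (ξ₋ E φ) (nnf¬ φ)

  -- The expressions occurring in ξ ∈ Sᵇ are atomic, so the first group of
  -- premises is p ≈ p for the 𝓛-variables p, together with q ≈ q for any
  -- 𝓛-constants q of ξ.  Without the latter the rule would bring q into every
  -- tableau, whatever the input.
  ruleᵇ : Sentence → Rule
  ruleᵇ ξ = rule (map ≈ᵉ-self (concatMap (concatMap ⁺.occL) cs) ++ ȳ≈ȳ cs) cs
    where cs = disjunctiveForm ξ (nnf ξ)

  signed : ∀ {V} → Bool → ⁺.Atom V → ⁺.Literal V
  signed true  = ⁺.pos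
  signed false = ⁺.neg

  -- In the rules below, the domain variables are x̄, given by `just`, and y,
  -- given by `nothing`.
  private
    xs : ∀ {n} → Vec (⁺.Term (Maybe (Fin n))) n
    xs = tabulate (⁺.var ∘ just)

    x : ∀ {n} → Fin n → ⁺.Term (Maybe (Fin n))
    x k = ⁺.var (just k)

    yʳ : ∀ {n} → ⁺.Term (Maybe (Fin n))
    yʳ = ⁺.var nothing

    ⟨_⟩ : ∀ {R} → Vec (⁺.Term (Maybe (Fin (⁺.arityᴿ R)))) (⁺.arityᴿ R) → ⁺.Atom _
    ⟨_⟩ {R} = ⁺.rel R (variables _)

    fx : ∀ f → Vec (⁺.Term (Maybe (Fin (⁺.arity f)))) (⁺.arity f) → ⁺.Term _
    fx f = ⁺.fn f (variables _)

  -- The predicate symbols R include the νₙ and the equality predicates of all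
  -- sorts.
  data LogicalRule : Rule → Set₁ where
    arguments : ∀ s R → LogicalRule (rule
      (signed s (⟨_⟩ {R} xs) ∷ [])
      ((map ≈ᵉ-self (expressions (variables (⁺.sortsᴿ R)))
          ++ map ≈ᵗ-self (Vec.toList xs)) ∷ []))
    symᴱ   : ∀ i → LogicalRule (rule {⊥}
      (⁺.pos (var {i} 0 ⁺.≈ᵉ var 1) ∷ [])
      ((⁺.pos (var {i} 1 ⁺.≈ᵉ var 0) ∷ []) ∷ []))
    transᴱ : ∀ i → LogicalRule (rule {⊥}
      (⁺.pos (var {i} 0 ⁺.≈ᵉ var 1) ∷ ⁺.pos (var {i} 1 ⁺.≈ᵉ var 2) ∷ [])
      ((⁺.pos (var {i} 0 ⁺.≈ᵉ var 2) ∷ []) ∷ []))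
    symᴰ   : LogicalRule (rule
      (⁺.pos (x {2} zero ⁺.≈ᵃ x (suc zero)) ∷ [])
      ((⁺.pos (x (suc zero) ⁺.≈ᵃ x zero) ∷ []) ∷ []))
    transᴰ : LogicalRule (rule
      (⁺.pos (x {3} zero ⁺.≈ᵃ x (suc zero))
        ∷ ⁺.pos (x (suc zero) ⁺.≈ᵃ x (suc (suc zero))) ∷ [])
      ((⁺.pos (x zero ⁺.≈ᵃ x (suc (suc zero))) ∷ []) ∷ []))
    congᴿ  : ∀ R (k : Fin (⁺.arityᴿ R)) → LogicalRule (rule
      (⁺.pos (⟨_⟩ {R} xs) ∷ ⁺.pos (x k ⁺.≈ᵃ yʳ) ∷ [])
      ((⁺.pos (⟨_⟩ {R} (xs [ k ]≔ yʳ)) ∷ []) ∷ []))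
    congᶠ  : ∀ f (k : Fin (⁺.arity f)) → LogicalRule (rule
      (⁺.pos (fx f xs ⁺.≈ᵃ fx f xs) ∷ ⁺.pos (x k ⁺.≈ᵃ yʳ) ∷ [])
      ((⁺.pos (fx f xs ⁺.≈ᵃ fx f (xs [ k ]≔ yʳ)) ∷ []) ∷ []))
    close  : ∀ R → LogicalRule (rule
      (⁺.pos (⟨_⟩ {R} xs) ∷ ⁺.neg (⟨_⟩ {R} xs) ∷ []) [])

  Calculus : Set₂
  Calculus = Rule → Set₁

  module _ {𝓢 : SemanticSpecification} (𝓝 : Normalised 𝓢) where
    open Normalised 𝓝

    data generatedCalculus : Calculus where
      plus       : ∀ {i} {E : Expr (suc i)} {φ} → S⁺ (ξ₊ E φ) → generatedCalculus (rule₊ E φ)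
      minus      : ∀ {i} {E : Expr (suc i)} {φ} → S⁻ (ξ₋ E φ) → generatedCalculus (rule₋ E φ)
      background : ∀ {ξ} → Sᵇ ξ → ¬ EqualityAxiom ξ → generatedCalculus (ruleᵇ ξ)
      logical    : ∀ {r} → LogicalRule r → generatedCalculus r

  -- 𝓛-variables remain in ground literals, being expressions themselves.
  GroundLiteral : Set
  GroundLiteral = ⁺.Literal ⊥

  root : Pred Concept 0ℓ → Pred GroundLiteral 0ℓ
  root 𝒮 L = ∃[ C ] (𝒮 C × L ≡ ⁺.pos (⁺.νᵃ zero C (a ∷ [])))
    where a = ⁺.fn (⁺.fun (inj₂ (inj₂ tt))) [] []

  module Tableaux (T : Calculus) where

    record Application : Set₁ where
      field
        from    : Rule
        from∈T  : T from
        onExpr  : Subst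
        onDom   : Rule.DomVar from → ⁺.Term ⊥

      premises : List GroundLiteral
      premises = map (⁺.substL onExpr onDom) (Rule.premises from)

      successors : List (List GroundLiteral)
      successors = map (map (⁺.substL onExpr onDom)) (Rule.denominators from)

    open Application

    SameApplication : Application → Application → Set₁
    SameApplication α β = from α ≡ from β × premises α ≡ premises β

    -- i ∷ π is the i-th child of the position π.
    Position : Set
    Position = List ℕ

    -- A tree of rule applications, with `nothing` at the leaves to which no
    -- rule is applied; its values outside `Node` are irrelevant.
    Strategy : Set₁
    Strategy = Position → Maybe Application

    module _ (step : Strategy) where

      Node : Position → Set
      Node []      = ⊤
      Node (i ∷ π) = Node π × Child (step π)
        where
        Child : Maybe Application → Set
        Child nothing  = ⊥
        Child (just α) = i < length (successors α)

      label : Pred Concept 0ℓ → Position → Pred GroundLiteral 0ℓ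
      label 𝒮 []      L = root 𝒮 L
      label 𝒮 (i ∷ π) L = label 𝒮 π L ⊎ Added (step π)
        where
        Added : Maybe Application → Set
        Added nothing  = ⊥
        Added (just α) =
          ∃[ k ] (toℕ {length (successors α)} k ≡ i × L ∈ lookup (successors α) k)

    record Tableau (𝒮 : Pred Concept 0ℓ) : Set₁ where
      field
        step       : Strategy
        applicable : ∀ {π α} → Node step π → step π ≡ just α →
                     All (label step 𝒮 π) (premises α)
        once       : ∀ {π i ρ α β} → Node step (i ∷ ρ ++ π) →
                     step π ≡ just α → step (i ∷ ρ ++ π) ≡ just β →
                     ¬ SameApplication α β

    prefix : (ℕ → ℕ) → ℕ → Position
    prefix b zero    = []
    prefix b (suc n) = b n ∷ prefix b n

    module _ {𝒮 : Pred Concept 0ℓ} (τ : Tableau 𝒮) where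
      open Tableau τ

      -- The values of b beyond the end of a finite branch are irrelevant.
      Branch : (ℕ → ℕ) → Set₁
      Branch b = ∀ {n α} → Node step (prefix b n) → step (prefix b n) ≡ just α →
                 successors α ≢ [] → Node step (prefix b (suc n))

      -- On every branch, each application whose premises are present is
      -- eventually made, unless the branch is closed.
      Finished : Set₁
      Finished = ∀ b → Branch b → ∀ {n} → Node step (prefix b n) →
        ∀ α → All (label step 𝒮 (prefix b n)) (premises α) →
        ¬ ¬ (∃[ m ] ∃[ β ] (Node step (prefix b m) × step (prefix b m) ≡ just β
                            × (SameApplication α β ⊎ successors β ≡ [])))

      _occurs : Expression → Set
      E occurs = ∃[ π ] ∃[ L ] (Node step π × label step 𝒮 π L × E ∈ ⁺.occL L)

    SubexpressionProperty : Rel Expression 0ℓ → Set₁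
    SubexpressionProperty _⊑_ =
      ∀ (𝒮 : Pred Concept 0ℓ) (τ : Tableau 𝒮) → Finished τ →
      ∀ E → (τ occurs) E → ∃[ C ] (𝒮 C × E ⊑ (suc zero , C))

  open Tableaux public using (SubexpressionProperty)

{-# OPTIONS --safe #-}

-- A rule whose denominators mention only expressions ≼-below those of its
-- premises keeps every branch inside sub_≼(𝒮).  For the rules obtained from ξ^E_±
-- the expressions of the denominators are, by definition, ≺-below the instance
-- of E in the main premise (Skolem terms only repeat expressions of φ^E_±); for
-- all other rules they already occur in the premises.  Likewise every domain
-- variable of a denominator occurs in a premise, so that no expression enters
-- through the terms substituted for domain variables.
module Submission where

open import Defs

open import Level using (0ℓ)
open import Data.Bool using (true; false)
open import Data.Fin using (Fin; zero; suc; toℕ)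
open import Data.List using (List; []; _∷_; _++_; map; concatMap; mapMaybe)
open import Data.List.Membership.Propositional using (_∈_)
open import Data.List.Membership.Propositional.Properties using (∈-lookup)
open import Data.List.Relation.Unary.All as All using (All; []; _∷_)
open import Data.List.Relation.Unary.All.Properties
  using (++⁺; ++⁻ˡ; ++⁻ʳ; map⁺; map⁻; concat⁻; cartesianProductWith⁺)
open import Data.Maybe using (just)
open import Data.Nat using (ℕ; zero; suc)
open import Data.Product using (∃-syntax; _×_; _,_; proj₁; proj₂; uncurry)
open import Data.Sum using (_⊎_; inj₁; inj₂; isInj₂)
open import Data.Vec as Vec using (Vec; []; _∷_; _[_]≔_)
open import Data.Vec.Relation.Unary.All using ([]; _∷_) renaming (All to AllVec)
open import Data.Vec.Relation.Unary.All.Properties using (tabulate⁻; toList⁺)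
open import Function using (_∘_)
open import Relation.Binary.Construct.Closure.Reflexive using (refl; [_])
open import Relation.Binary.Construct.Closure.Transitive using ([_]; _∷_)
open import Relation.Binary.PropositionalEquality using (_≡_; refl; sym; subst; setoid)
open import Relation.Unary using (Pred)

-- Predicates over vectors and lists.

module _ {A : Set} {P : Pred A 0ℓ} where

  All-[]≔ : ∀ {n} {xs : Vec A n} {x} k → AllVec P xs → P x → AllVec P (xs [ k ]≔ x)
  All-[]≔ zero    (_ ∷ pxs)  px = px ∷ pxs
  All-[]≔ (suc k) (py ∷ pxs) px = py ∷ All-[]≔ k pxs px

module _ {A B : Set} {P : Pred B 0ℓ} where

  concatMap⁻ : (f : A → List B) → ∀ {xs} → All P (concatMap f xs) → All (All P ∘ f) xs
  concatMap⁻ f = map⁻ ∘ concat⁻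

module _ {A B : Set} {P : Pred (A ⊎ B) 0ℓ} where

  -- The premises `ȳ≈ȳ` of a rule speak only of its quantifier variables, tagged `inj₂`; the
  -- variables x̄, tagged `inj₁`, have to be supplied from elsewhere.
  mapMaybe-isInj₂⁻ : (∀ x → P (inj₁ x)) → ∀ xs →
                     All (P ∘ inj₂) (mapMaybe isInj₂ xs) → All P xs
  mapMaybe-isInj₂⁻ p₁ []            []       = []
  mapMaybe-isInj₂⁻ p₁ (inj₁ x ∷ xs) ps       = p₁ x ∷ mapMaybe-isInj₂⁻ p₁ xs ps
  mapMaybe-isInj₂⁻ p₁ (inj₂ y ∷ xs) (p ∷ ps) = p ∷ mapMaybe-isInj₂⁻ p₁ xs ps

-- Substitution in tuples of expressions.

module Expressions (𝓛 : Language) where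
  open Syntax 𝓛

  instE : Subst → Expression → Expression
  instE θ (i , E) = i , substE θ E

  expressions-substEs : ∀ θ {is} (es : All Expr is) →
                        expressions (substEs θ es) ≡ map (instE θ) (expressions es)
  expressions-substEs θ []       = refl
  expressions-substEs θ (e ∷ es) rewrite expressions-substEs θ es = refl

  expressions-packed : ∀ es → expressions (packed es) ≡ es
  expressions-packed []       = refl
  expressions-packed (e ∷ es) rewrite expressions-packed es = refl

-- Bounds on the literals of a rule and on their instances.

module Bounds (𝓛 : Language) (Γ : Syntax.Signature 𝓛) where
  open Syntax 𝓛
  open Terms Γ
  open Expressions 𝓛

  module _ {V : Set} (Q : Pred Expression 0ℓ) (R : Pred V 0ℓ) where

    BoundedT : Pred (Term V) 0ℓ
    BoundedT t = All Q (occT t) × All R (domVarsT t)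

    BoundedTs : ∀ {n} → Pred (Vec (Term V) n) 0ℓ
    BoundedTs ts = All Q (occTs ts) × All R (domVarsTs ts)

    -- An expression reaches an instance of a literal from one of two sources: the expressions of
    -- the literal itself, restricted by `Q`, and the values of its domain variables, restricted by
    -- `R`. A record type lets unification recover `L`.
    record BoundedL (L : Literal V) : Set where
      constructor bounded
      field
        occurrences : All Q (occL L)
        domVars     : All R (domVarsL L)

  module _ {V : Set} {Q : Pred Expression 0ℓ} {R : Pred V 0ℓ} where

    boundedTs⁺ : ∀ {n} {ts : Vec (Term V) n} → AllVec (BoundedT Q R) ts → BoundedTs Q R ts
    boundedTs⁺ []              = [] , []
    boundedTs⁺ ((q , r) ∷ bts) =
      let qs , rs = boundedTs⁺ bts in ++⁺ q qs , ++⁺ r rs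

    boundedTs⁻ : ∀ {n} (ts : Vec (Term V) n) → BoundedTs Q R ts → AllVec (BoundedT Q R) ts
    boundedTs⁻ []       _         = []
    boundedTs⁻ (t ∷ ts) (qs , rs) =
      (++⁻ˡ (occT t) qs , ++⁻ˡ (domVarsT t) rs) ∷
      boundedTs⁻ ts (++⁻ʳ (occT t) qs , ++⁻ʳ (domVarsT t) rs)

    fn-bounded⁺ : ∀ {f es ts} → All Q (expressions es) → AllVec (BoundedT Q R) ts →
                  BoundedT Q R (fn f es ts)
    fn-bounded⁺ qs bts = let qs′ , rs = boundedTs⁺ bts in ++⁺ qs qs′ , rs

    fn-bounded⁻ : ∀ {f es ts} → BoundedT Q R (fn f es ts) →
                  All Q (expressions es) × AllVec (BoundedT Q R) ts
    fn-bounded⁻ {es = es} (qs , rs) =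
      ++⁻ˡ (expressions es) qs , boundedTs⁻ _ (++⁻ʳ (expressions es) qs , rs)

    atom-bounded⁺ : ∀ {S es ts} → All Q (expressions es) → AllVec (BoundedT Q R) ts →
                    BoundedL Q R (pos (rel S es ts))
    atom-bounded⁺ qs bts = let qs′ , rs = boundedTs⁺ bts in bounded (++⁺ qs qs′) rs

    neg⇒pos : ∀ {S es ts} → BoundedL Q R (neg (rel S es ts)) → BoundedL Q R (pos (rel S es ts))
    neg⇒pos (bounded qs rs) = bounded qs rs

    atom-bounded⁻ : ∀ {S es ts} → BoundedL Q R (pos (rel S es ts)) →
                    All Q (expressions es) × AllVec (BoundedT Q R) ts
    atom-bounded⁻ {es = es} (bounded qs rs) =
      ++⁻ˡ (expressions es) qs , boundedTs⁻ _ (++⁻ʳ (expressions es) qs , rs)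

  module _ {V W : Set} (P : Pred Expression 0ℓ) (θ : Subst) (ρ : V → Term W) where

    private
      -- `Q` and `R` pull `P` back along the instantiation, so that a literal is bounded exactly
      -- when `P` holds of all occurrences in its instance. The lemmas marked `⁻` serve for
      -- premises, those marked `⁺` for denominators.
      Q : Pred Expression 0ℓ
      Q = P ∘ instE θ

      R : Pred V 0ℓ
      R = All P ∘ occT ∘ ρ

      expressions⁺ : ∀ {is} (es : All Expr is) →
                     All Q (expressions es) → All P (expressions (substEs θ es))
      expressions⁺ es = subst (All P) (sym (expressions-substEs θ es)) ∘ map⁺

      expressions⁻ : ∀ {is} (es : All Expr is) →
                     All P (expressions (substEs θ es)) → All Q (expressions es)
      expressions⁻ es = map⁻ ∘ subst (All P) (expressions-substEs θ es)

    mutual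
      occT-subst⁺ : ∀ t → BoundedT Q R t → All P (occT (substT θ ρ t))
      occT-subst⁺ (var x)      (_ , r ∷ []) = r
      occT-subst⁺ (fn f es ts) (qs , rs)    =
        ++⁺ (expressions⁺ es (++⁻ˡ (expressions es) qs))
            (occTs-subst⁺ ts (++⁻ʳ (expressions es) qs , rs))

      occTs-subst⁺ : ∀ {n} (ts : Vec (Term V) n) →
                     BoundedTs Q R ts → All P (occTs (substTs θ ρ ts))
      occTs-subst⁺ []       _         = []
      occTs-subst⁺ (t ∷ ts) (qs , rs) =
        ++⁺ (occT-subst⁺ t (++⁻ˡ (occT t) qs , ++⁻ˡ (domVarsT t) rs))
            (occTs-subst⁺ ts (++⁻ʳ (occT t) qs , ++⁻ʳ (domVarsT t) rs))

    occL-subst⁺ : ∀ L → BoundedL Q R L → All P (occL (substL θ ρ L))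
    occL-subst⁺ (pos (rel _ es ts)) (bounded qs rs) =
      ++⁺ (expressions⁺ es (++⁻ˡ (expressions es) qs))
          (occTs-subst⁺ ts (++⁻ʳ (expressions es) qs , rs))
    occL-subst⁺ (neg (rel S es ts)) (bounded qs rs) = occL-subst⁺ (pos (rel S es ts)) (bounded qs rs)

    mutual
      occT-subst⁻ : ∀ t → All P (occT (substT θ ρ t)) → BoundedT Q R t
      occT-subst⁻ (var x)      ps = [] , ps ∷ []
      occT-subst⁻ (fn f es ts) ps =
        let qs , rs = occTs-subst⁻ ts (++⁻ʳ (expressions (substEs θ es)) ps)
        in ++⁺ (expressions⁻ es (++⁻ˡ (expressions (substEs θ es)) ps)) qs , rs

      occTs-subst⁻ : ∀ {n} (ts : Vec (Term V) n) →
                     All P (occTs (substTs θ ρ ts)) → BoundedTs Q R ts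
      occTs-subst⁻ []       ps = [] , []
      occTs-subst⁻ (t ∷ ts) ps =
        let qs , rs   = occT-subst⁻ t (++⁻ˡ (occT (substT θ ρ t)) ps)
            qs′ , rs′ = occTs-subst⁻ ts (++⁻ʳ (occT (substT θ ρ t)) ps)
        in ++⁺ qs qs′ , ++⁺ rs rs′

    occL-subst⁻ : ∀ L → All P (occL (substL θ ρ L)) → BoundedL Q R L
    occL-subst⁻ (pos (rel _ es ts)) ps =
      let qs , rs = occTs-subst⁻ ts (++⁻ʳ (expressions (substEs θ es)) ps)
      in bounded (++⁺ (expressions⁻ es (++⁻ˡ (expressions (substEs θ es)) ps)) qs) rs
    occL-subst⁻ (neg (rel S es ts)) ps =
      let bounded qs rs = occL-subst⁻ (pos (rel S es ts)) ps in bounded qs rs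

-- Occurrences under negation normal form and Skolemisation.

module Rules (𝓛 : Language) (Γ : Syntax.Signature 𝓛) where
  open FO 𝓛 Γ
  open Expressions 𝓛
  open Bounds 𝓛 Γ using () renaming (occL-subst⁻ to occL-subst⁻₀)
  open Bounds 𝓛 Γ⁺

  -- The ordering refers to occurrences in the instance of `φ`, whereas the clauses of a rule are
  -- built from `φ` itself; this pulls a bound back from the former to the latter.
  occF-subst⁻ : ∀ {P θ n} (φ : Formula n) → All P (occF (substF θ φ)) → All (P ∘ instE θ) (occF φ)
  occF-subst⁻ {P} {θ} (atom A) ps = Bounds.BoundedL.occurrences (occL-subst⁻₀ P θ var (pos A) ps)
  occF-subst⁻ ⊥ᶠ       ps = []
  occF-subst⁻ (¬ᶠ φ)   ps = occF-subst⁻ φ ps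
  occF-subst⁻ {θ = θ} (φ ∧ᶠ ψ) ps =
    ++⁺ (occF-subst⁻ φ (++⁻ˡ _ ps)) (occF-subst⁻ ψ (++⁻ʳ (occF (substF θ φ)) ps))
  occF-subst⁻ {θ = θ} (φ ∨ᶠ ψ) ps =
    ++⁺ (occF-subst⁻ φ (++⁻ˡ _ ps)) (occF-subst⁻ ψ (++⁻ʳ (occF (substF θ φ)) ps))
  occF-subst⁻ {θ = θ} (φ ⇒ᶠ ψ) ps =
    ++⁺ (occF-subst⁻ φ (++⁻ˡ _ ps)) (occF-subst⁻ ψ (++⁻ʳ (occF (substF θ φ)) ps))
  occF-subst⁻ (∀ᶠ φ)   ps = occF-subst⁻ φ ps
  occF-subst⁻ (∃ᶠ φ)   ps = occF-subst⁻ φ ps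

  mutual
    -- Pushing negations inwards neither drops, duplicates nor reorders atoms, so the two lists are
    -- equal and not merely equal as sets.
    occN-nnf : ∀ {n} (φ : Formula n) → occN (nnf φ) ≡ occF φ
    occN-nnf (atom A) = refl
    occN-nnf ⊥ᶠ       = refl
    occN-nnf (¬ᶠ φ)   = occN-nnf¬ φ
    occN-nnf (φ ∧ᶠ ψ) rewrite occN-nnf φ | occN-nnf ψ = refl
    occN-nnf (φ ∨ᶠ ψ) rewrite occN-nnf φ | occN-nnf ψ = refl
    occN-nnf (φ ⇒ᶠ ψ) rewrite occN-nnf¬ φ | occN-nnf ψ = refl
    occN-nnf (∀ᶠ φ)   = occN-nnf φ
    occN-nnf (∃ᶠ φ)   = occN-nnf φ

    occN-nnf¬ : ∀ {n} (φ : Formula n) → occN (nnf¬ φ) ≡ occF φ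
    occN-nnf¬ (atom A) = refl
    occN-nnf¬ ⊥ᶠ       = refl
    occN-nnf¬ (¬ᶠ φ)   = occN-nnf φ
    occN-nnf¬ (φ ∧ᶠ ψ) rewrite occN-nnf¬ φ | occN-nnf¬ ψ = refl
    occN-nnf¬ (φ ∨ᶠ ψ) rewrite occN-nnf¬ φ | occN-nnf¬ ψ = refl
    occN-nnf¬ (φ ⇒ᶠ ψ) rewrite occN-nnf φ | occN-nnf¬ ψ = refl
    occN-nnf¬ (∀ᶠ φ)   = occN-nnf¬ φ
    occN-nnf¬ (∃ᶠ φ)   = occN-nnf¬ φ

  module _ {Q : Pred Expression 0ℓ} where

    module _ {V W : Set} (ρ : V → ⁺.Term W) (ρ-occ : ∀ x → All Q (⁺.occT (ρ x))) where
      mutual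
        occT-embed : ∀ t → All Q (occT t) → All Q (⁺.occT (embedT ρ t))
        occT-embed (var x)            qs = ρ-occ x
        occT-embed (fn ν₀ es [])      qs = qs
        occT-embed (fn (fun f) es ts) qs =
          ++⁺ (++⁻ˡ (expressions es) qs) (occTs-embed ts (++⁻ʳ (expressions es) qs))

        occTs-embed : ∀ {n} (ts : Vec (Term V) n) →
                      All Q (occTs ts) → All Q (⁺.occTs (embedTs ρ ts))
        occTs-embed []       qs = []
        occTs-embed (t ∷ ts) qs =
          ++⁺ (occT-embed t (++⁻ˡ (occT t) qs)) (occTs-embed ts (++⁻ʳ (occT t) qs))

      occA-embed : ∀ A → All Q (occA A) → All Q (⁺.occA (embedA ρ A))
      occA-embed (rel (ν i) es ts)    qs =
        ++⁺ (++⁻ˡ (expressions es) qs) (occTs-embed ts (++⁻ʳ (expressions es) qs))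
      occA-embed (rel (pred P) es ts) qs =
        ++⁺ (++⁻ˡ (expressions es) qs) (occTs-embed ts (++⁻ʳ (expressions es) qs))
      occA-embed (rel (≈ᴱ i) es ts)   qs =
        ++⁺ (++⁻ˡ (expressions es) qs) (occTs-embed ts (++⁻ʳ (expressions es) qs))
      occA-embed (rel ≈ᴰ es ts)       qs =
        ++⁺ (++⁻ˡ (expressions es) qs) (occTs-embed ts (++⁻ʳ (expressions es) qs))

      occL-embed : ∀ L → All Q (occL L) → All Q (⁺.occL (embedL ρ L))
      occL-embed (pos A) = occA-embed A
      occL-embed (neg A) = occA-embed A

    occTs-vars : ∀ {V n} (xs : Vec V n) → All Q (⁺.occTs (Vec.map ⁺.var xs))
    occTs-vars []       = []
    occTs-vars (x ∷ xs) = occTs-vars xs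

    module _ (ξ : Sentence) {k : ℕ} where
      open Skolemisation ξ {k}

      -- Apart from Skolem terms, the clauses only redistribute the literals of `F`. The invariant
      -- on `ρ` accounts for the Skolem terms already substituted for existential variables.
      occ-clauses : ∀ {n} π scope {ρ : Fin n → ⁺.Term (RuleVar k)} (F : NNF n) →
                    (∀ x → All Q (⁺.occT (ρ x))) → All Q (occN F) →
                    All (All (All Q ∘ ⁺.occL)) (clauses π scope ρ F)
      occ-clauses π scope (lit L)  ρ-occ qs = (occL-embed _ ρ-occ L qs ∷ []) ∷ []
      occ-clauses π scope ⊤ᴺ       ρ-occ qs = [] ∷ []
      occ-clauses π scope ⊥ᴺ       ρ-occ qs = []
      occ-clauses π scope {ρ} (F ∧ᴺ G) ρ-occ qs = cartesianProductWith⁺ (setoid _) (setoid _) _++_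
        (clauses (false ∷ π) scope ρ F) (clauses (true ∷ π) scope ρ G)
        λ c∈F d∈G → ++⁺
          (All.lookup (occ-clauses (false ∷ π) scope F ρ-occ (++⁻ˡ (occN F) qs)) c∈F)
          (All.lookup (occ-clauses (true ∷ π) scope G ρ-occ (++⁻ʳ (occN F) qs)) d∈G)
      occ-clauses π scope (F ∨ᴺ G) ρ-occ qs =
        ++⁺ (occ-clauses (false ∷ π) scope F ρ-occ (++⁻ˡ (occN F) qs))
            (occ-clauses (true ∷ π) scope G ρ-occ (++⁻ʳ (occN F) qs))
      occ-clauses π scope (∀ᴺ F)   ρ-occ qs =
        occ-clauses (false ∷ π) (inj₂ π ∷ scope) F (λ { zero → [] ; (suc x) → ρ-occ x }) qs
      occ-clauses π scope (∃ᴺ F)   ρ-occ qs =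
        occ-clauses (false ∷ π) scope F (λ { zero → witness-occ ; (suc x) → ρ-occ x }) qs
        where
        witness-occ : All Q (⁺.occT (witness π scope F))
        -- The 𝓛-arguments of the Skolem term are the occurrences of the subformula it witnesses;
        -- its domain arguments are variables and contribute none.
        witness-occ = ++⁺ (subst (All Q) (sym (expressions-packed (occN F))) qs)
                          (occTs-vars (Vec.fromList scope))

      occ-disjunctiveForm : ∀ F → All Q (occN F) →
                            All (All (All Q ∘ ⁺.occL)) (disjunctiveForm F)
      occ-disjunctiveForm F = occ-clauses [] _ F (λ _ → [])

    module _ {n : ℕ} {R : Pred (RuleVar n) 0ℓ} (cs : Clauses (RuleVar n)) where

      -- A variable of a clause is either one of the x̄, covered by the first hypothesis, or a
      -- quantifier variable y, for which `ȳ≈ȳ` contains a premise y ≈ y.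
      domVars-clauses : (∀ k → R (inj₁ k)) → All (BoundedL Q R) (ȳ≈ȳ cs) →
                        All (All (All R ∘ ⁺.domVarsL)) cs
      domVars-clauses x̄∈R ȳ∈R =
        All.map (concatMap⁻ ⁺.domVarsL) (concatMap⁻ (concatMap ⁺.domVarsL)
          (mapMaybe-isInj₂⁻ x̄∈R _ (All.map (All.head ∘ BoundedL.domVars) (map⁻ ȳ∈R))))

      boundedClauses : (∀ k → R (inj₁ k)) → All (BoundedL Q R) (ȳ≈ȳ cs) →
                       All (All (All Q ∘ ⁺.occL)) cs → All (All (BoundedL Q R)) cs
      boundedClauses x̄∈R ȳ∈R qs =
        All.zipWith (All.zipWith (uncurry bounded)) (qs , domVars-clauses x̄∈R ȳ∈R)

    -- Equality and closure rules.

    module _ {V : Set} {R : Pred V 0ℓ} where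

      ≈ᴰ-bounded : ∀ {s t} → BoundedT Q R s → BoundedT Q R t →
                   BoundedL Q R (⁺.pos (s ⁺.≈ᵃ t))
      ≈ᴰ-bounded bs bt = atom-bounded⁺ [] (bs ∷ bt ∷ [])

      self-bounded : ∀ {t} → BoundedT Q R t → BoundedL Q R (≈ᵗ-self t)
      self-bounded bt = ≈ᴰ-bounded bt bt

      arguments-bounded : ∀ {S es ts} → BoundedL Q R (⁺.pos (⁺.rel S es ts)) →
        All (BoundedL Q R) (map ≈ᵉ-self (expressions es) ++ map ≈ᵗ-self (Vec.toList ts))
      arguments-bounded b =
        let qs , bts = atom-bounded⁻ b in
        ++⁺ (map⁺ (All.map (λ q → bounded (q ∷ q ∷ []) []) qs))
            (map⁺ (All.map self-bounded (toList⁺ bts)))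

      -- Every expression and every domain variable of a denominator already stands in a premise, so
      -- arbitrary `Q` and `R` are preserved.
      logical-bounded : ∀ {ps ds} → LogicalRule (rule ps ds) →
                        All (BoundedL Q R) ps → All (All (BoundedL Q R)) ds
      logical-bounded (arguments true Rel)  (b ∷ []) = arguments-bounded b ∷ []
      logical-bounded (arguments false Rel) (b ∷ []) = arguments-bounded (neg⇒pos b) ∷ []
      logical-bounded (symᴱ i) (bounded (p ∷ q ∷ []) _ ∷ []) = (bounded (q ∷ p ∷ []) [] ∷ []) ∷ []
      logical-bounded (transᴱ i) (bounded (p ∷ _ ∷ []) _ ∷ bounded (_ ∷ q ∷ []) _ ∷ []) =
        (bounded (p ∷ q ∷ []) [] ∷ []) ∷ []
      logical-bounded symᴰ (b ∷ []) with atom-bounded⁻ b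
      ... | _ , bx ∷ by ∷ [] = (≈ᴰ-bounded by bx ∷ []) ∷ []
      logical-bounded transᴰ (b ∷ b′ ∷ []) with atom-bounded⁻ b | atom-bounded⁻ b′
      ... | _ , bx ∷ _ ∷ [] | _ , _ ∷ bz ∷ [] = (≈ᴰ-bounded bx bz ∷ []) ∷ []
      logical-bounded (congᴿ Rel k) (b ∷ b′ ∷ []) with atom-bounded⁻ b | atom-bounded⁻ b′
      ... | qs , bts | _ , _ ∷ by ∷ [] = (atom-bounded⁺ qs (All-[]≔ k bts by) ∷ []) ∷ []
      logical-bounded (congᶠ f k) (b ∷ b′ ∷ []) with atom-bounded⁻ b | atom-bounded⁻ b′
      ... | _ , bf ∷ _ ∷ [] | _ , _ ∷ by ∷ [] =
        -- `BoundedT` unfolds to a pair of `All` types, from which the symbol and its arguments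
        -- cannot be inferred; they are passed explicitly.
        let es       = variables _
            xs       = Vec.tabulate (⁺.var ∘ just)
            qs , bts = fn-bounded⁻ {f = f} {es} {xs} bf
        in (≈ᴰ-bounded bf (fn-bounded⁺ {f = f} {es} qs (All-[]≔ k bts by)) ∷ []) ∷ []
      logical-bounded (close Rel) _ = []

  -- Rules of the generated calculus.

  module _ {𝓢 : SemanticSpecification} (𝓝 : Normalised 𝓢) where
    open Normalised 𝓝

    module _ {P : Pred Expression 0ℓ} (P-closed : ∀ {E E′} → E′ ≺₁ E → P E → P E′) (θ : Subst) where

      private
        Q : Pred Expression 0ℓ
        Q = P ∘ instE θ

      module _ {i} {E : Expr (suc i)} (φ : Formula (suc (toℕ i)))
               {R : Pred (RuleVar (suc (toℕ i))) 0ℓ}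
               (φ≺E : ∀ {E′} → E′ ∈ occF (substF θ φ) → E′ ≺₁ (suc i , substE θ E)) where

        -- Both signs are treated at once: `F` is the negation normal form of `φ` or of its
        -- negation, and only its occurrences matter. A negative main premise has the same bound as
        -- its atom.
        defining-bounded : ∀ ξ F → occN F ≡ occF φ →
          let cs = Skolemisation.disjunctiveForm ξ F in
          BoundedL Q R (⁺.pos (⁺.νᵃ i E x̄ʳ)) → All (BoundedL Q R) (ȳ≈ȳ cs) →
          All (All (BoundedL Q R)) cs
        defining-bounded ξ F occF≡ b ȳ∈R =
          let qs , bts = atom-bounded⁻ b
              -- The domain arguments of the main premise are exactly the x̄.
              x̄∈R = All.head ∘ proj₂ ∘ tabulate⁻ {f = ⁺.var ∘ inj₁} bts
              -- `All.head qs` is `P` for the instance of `E`; closure under `≺₁` carries it to the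
              -- instance of `φ`.
              φ∈Q = occF-subst⁻ φ (All.tabulate (λ E′∈φ → P-closed (φ≺E E′∈φ) (All.head qs)))
          in boundedClauses _ x̄∈R ȳ∈R
               (occ-disjunctiveForm ξ F (subst (All Q) (sym occF≡) φ∈Q))

      rule-bounded : ∀ {r} → generatedCalculus 𝓝 r → ∀ {R} →
                     All (BoundedL Q R) (Rule.premises r) →
                     All (All (BoundedL Q R)) (Rule.denominators r)
      rule-bounded (plus {E = E} {φ} ξ∈S⁺) (b ∷ bs) =
        defining-bounded φ (plus (inst E φ θ ξ∈S⁺)) (ξ₊ E φ) (nnf φ) (occN-nnf φ) b bs
      rule-bounded (minus {E = E} {φ} ξ∈S⁻) (b ∷ bs) =
        defining-bounded φ (minus (inst E φ θ ξ∈S⁻)) (ξ₋ E φ) (nnf¬ φ) (occN-nnf¬ φ)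
          (neg⇒pos b) bs
      rule-bounded (background {ξ} _ _) bs =
        -- A sentence has no free x̄, so its clauses contain quantifier variables only. Each
        -- expression of the clauses, Skolem arguments included, has its own self-equality among the
        -- premises.
        boundedClauses cs (λ ()) (++⁻ʳ (map ≈ᵉ-self es) bs)
          (All.map (concatMap⁻ ⁺.occL) (concatMap⁻ (concatMap ⁺.occL)
            (All.map (All.head ∘ BoundedL.occurrences) (map⁻ (++⁻ˡ (map ≈ᵉ-self es) bs)))))
        where
        cs = Skolemisation.disjunctiveForm ξ (nnf ξ)
        es = concatMap (concatMap ⁺.occL) cs
      rule-bounded (logical lr) bs = logical-bounded lr bs

    -- Labels along a tableau.

    open Tableaux (generatedCalculus 𝓝)

    module _ (𝒮 : Pred Concept 0ℓ) (τ : Tableau 𝒮) where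
      open Tableau τ

      sub≼ : Pred Expression 0ℓ
      sub≼ E = ∃[ C ] (𝒮 C × E ≼ (suc zero , C))

      sub≼-closed : ∀ {E E′} → E′ ≺₁ E → sub≼ E → sub≼ E′
      sub≼-closed E′≺E (C , C∈𝒮 , refl)    = C , C∈𝒮 , [ [ E′≺E ] ]
      sub≼-closed E′≺E (C , C∈𝒮 , [ E≺C ]) = C , C∈𝒮 , [ E′≺E ∷ E≺C ]

      -- The bound on the premises is pulled back to the uninstantiated rule, transferred there to
      -- the denominators, and pushed forward to the successors.
      application-sub≼ : (α : Application) → let open Application α in
        All (All sub≼ ∘ ⁺.occL) premises → All (All (All sub≼ ∘ ⁺.occL)) successors
      application-sub≼ α ps =
        map⁺ (All.map (map⁺ ∘ All.map (occL-subst⁺ sub≼ onExpr onDom _))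
          (rule-bounded sub≼-closed onExpr from∈T
            (All.map (occL-subst⁻ sub≼ onExpr onDom _) (map⁻ ps))))
        where open Application α

      -- Induction on the position: a rule is applied only when its premises lie in the label of the
      -- parent, where the induction hypothesis bounds them.
      label-sub≼ : ∀ π {L} → Node step π → label step 𝒮 π L → All sub≼ (⁺.occL L)
      -- The constant `a` has no arguments, so `C` is the only expression of a root literal.
      label-sub≼ []      _       (C , C∈𝒮 , refl) = (C , C∈𝒮 , refl) ∷ []
      label-sub≼ (i ∷ π) (π∈τ , _) (inj₁ L∈π) = label-sub≼ π π∈τ L∈π
      -- Nothing is added below a position without an application, which leaves the case `just α`;
      -- `eq` is what `applicable` requires.
      label-sub≼ (i ∷ π) (π∈τ , _) (inj₂ L∈Xᵢ) with step π in eq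
      ... | just α =
        let k , _ , L∈Xₖ = L∈Xᵢ in
        All.lookup (All.lookup (application-sub≼ α (All.map (label-sub≼ π π∈τ) (applicable π∈τ eq)))
                               (∈-lookup k)) L∈Xₖ

lemma8p1 : (𝓛 : Language) (Γ : Syntax.Signature 𝓛) → let open FO 𝓛 Γ in
    (𝓢 : SemanticSpecification) (wd : WellDefined 𝓢) →
    let 𝓝 = WellDefined.normalised wd in
    SubexpressionProperty (generatedCalculus 𝓝) (Normalised._≼_ 𝓝)
lemma8p1 𝓛 Γ 𝓢 wd 𝒮 τ _ E (π , L , π∈τ , L∈π , E∈L) =
  All.lookup (Rules.label-sub≼ 𝓛 Γ (FO.WellDefined.normalised wd) 𝒮 τ π π∈τ L∈π) E∈L
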